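{- Let $p$ be a prime integer. Let $\mathbb{Z}_p := \mathbb{Z}[[X]]/\!\sim$ be the commutative ring of $p$-adic integers, where $a\sim b$ means that the carried power series (mod $p$) of $a$ and $b$ are equal, i.e. $a^{\natural} = b^{\natural}$, with ring operations induced from $\mathbb{Z}[[X]]$. Equip $\mathbb{Z}_p$ with the apartness relation obtained by extending to the quotient the relation on $\mathbb{Z}[[X]]$ given by $$a \,\#\, b \quad\text{if and only if}\quad \exists n:\mathbb{N},\ \neg\,(a^{\natural}_n = b^{\natural}_n).$$ Then $\mathbb{Z}_p$ with this apartness relation is an apartness domain.
   Context: The setting is constructive (intuitionistic) mathematics in univalent type theory, with function extensionality and propositional univalence available. Equality $x=y$ means that the identity (path) type between $x$ and $y$ is inhabited; $\exists$ and "or" are the propositionally truncated existential quantifier and disjunction; relations are valued in propositions (types of h-level 1); quotients are set quotients. All rings are commutative with $1$. Prime: an integer $p$ is prime if $1<p$ and, for every positive integer $m$ dividing $p$, $m=1$ or $m=p$. Quotient and remainder: for an integer $c$, $\{c\}$ and $[c]$ denote the quotient and remainder of $c$ modulo $p$, i.e. the unique integers with $c = p\cdot\{c\}+[c]$ and $0\le [c]<p$. Formal power series: $\mathbb{Z}[[X]]$ is the set of sequences $a:\mathbb{N}\to\mathbb{Z}$ with $(a+b)_n := a_n+b_n$, $(a\cdot b)_n := \sum_{k=0}^n a_k b_{n-k}$, zero the constant sequence $0$, and unit given by $1_0:=1$, $1_{n+1}:=0$. Carrying: for $a\in\mathbb{Z}[[X]]$ define $\mathbf{p}(a)\in\mathbb{Z}[[X]]$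 by $\mathbf{p}(a)_0 := a_0$ and $\mathbf{p}(a)_{n+1} := a_{n+1}+\{\mathbf{p}(a)_n\}$. The carried power series of $a$ is $a^{\natural}$, given by $(a^{\natural})_n := [\mathbf{p}(a)_n]$. The equivalence relation $a\sim b :\Leftrightarrow a^{\natural}=b^{\natural}$ is a congruence for the ring operations of $\mathbb{Z}[[X]]$. An apartness relation on a set $X$ is a relation $R$ that is irreflexive ($\neg(xRx)$), symmetric ($xRy$ implies $yRx$) and cotransitive (if $xRy$, then for any $z$, $xRz$ or $zRy$). A commutative ring with compatible apartness is a commutative ring $A$ with an apartness relation $\#$ such that for all $a,b,c$ in $A$: (i) $(c+a)\,\#\,(c+b)$ implies $a\,\#\,b$; (ii) $(c\cdot a)\,\#\,(c\cdot b)$ implies $a\,\#\,b$. An apartness domain is a commutative ring with compatible apartness $A$ such that $1\,\#\,0$ and, for all $a,b$ in $A$, if $a\,\#\,0$ and $b\,\#\,0$ then $(a\cdot b)\,\#\,0$. -}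

module Defs where

open import Algebra.Core using (Op₁; Op₂)
open import Algebra.Structures using (IsCommutativeRing)
open import Data.Fin.Base using (toℕ)
open import Data.Integer.Base using (ℤ; 0ℤ; 1ℤ; +_; _+_; _*_; -_; _/_; _%_; _<_; +<+; NonZero; >-nonZero)
open import Data.Integer.Divisibility.Signed using (_∣_)
open import Data.Integer.Properties using (+-0-commutativeMonoid; <-trans)
open import Data.Nat.Base using (ℕ; zero; suc; _∸_; z<s)
open import Data.Product.Base using (∃-syntax)
open import Data.Sum.Base using (_⊎_)
open import Level using (_⊔_)
open import Relation.Binary.Core using (Rel)
open import Relation.Binary.Definitions using (_Respects₂_)
open import Relation.Binary.PropositionalEquality.Core using (_≡_; _≗_)
open import Relation.Binary.Structures using (IsApartnessRelation)
open import Relation.Nullary.Negation using (¬_)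
open import Algebra.Properties.CommutativeMonoid.Sum +-0-commutativeMonoid using (sum⁺-syntax)

-- Rings are setoid-based: _≈_ plays the role of equality on the underlying
-- set (for a quotient, the generating equivalence relation), so _#_ is asked
-- to respect it.

module _ {c ℓ₁ ℓ₂} {A : Set c} (_≈_ : Rel A ℓ₁) (_#_ : Rel A ℓ₂)
         (_⊕_ _⊛_ : Op₂ A) (⊖_ : Op₁ A) (𝟘 𝟙 : A) where

  record IsCommutativeRingWithCompatibleApartness : Set (c ⊔ ℓ₁ ⊔ ℓ₂) where
    field
      isCommutativeRing   : IsCommutativeRing _≈_ _⊕_ _⊛_ ⊖_ 𝟘 𝟙
      #-resp-≈            : _#_ Respects₂ _≈_
      isApartnessRelation : IsApartnessRelation _≈_ _#_
      +-reflects-#        : ∀ a b c → (c ⊕ a) # (c ⊕ b) → a # b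
      *-reflects-#        : ∀ a b c → (c ⊛ a) # (c ⊛ b) → a # b

  record IsApartnessDomain : Set (c ⊔ ℓ₁ ⊔ ℓ₂) where
    field
      isCommutativeRingWithCompatibleApartness : IsCommutativeRingWithCompatibleApartness
      1#0    : 𝟙 # 𝟘
      *-#0   : ∀ a b → a # 𝟘 → b # 𝟘 → (a ⊛ b) # 𝟘

record IsPrime (p : ℤ) : Set where
  field
    1<p      : 1ℤ < p
    divisors : ∀ m → 0ℤ < m → m ∣ p → m ≡ 1ℤ ⊎ m ≡ p

prime⇒nonZero : ∀ {p} → IsPrime p → NonZero p
prime⇒nonZero p-prime = >-nonZero (<-trans (+<+ z<s) (IsPrime.1<p p-prime))

ℤ⟦X⟧ : Set
ℤ⟦X⟧ = ℕ → ℤ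

infixl 6 _+ₛ_
infixl 7 _*ₛ_
infix  8 -ₛ_

_+ₛ_ : Op₂ ℤ⟦X⟧
(a +ₛ b) n = a n + b n

_*ₛ_ : Op₂ ℤ⟦X⟧
(a *ₛ b) n = ∑[ k ≤ n ] (a (toℕ k) * b (n ∸ toℕ k))

-ₛ_ : Op₁ ℤ⟦X⟧
(-ₛ a) n = - a n

0ₛ : ℤ⟦X⟧
0ₛ _ = 0ℤ

1ₛ : ℤ⟦X⟧
1ₛ zero    = 1ℤ
1ₛ (suc _) = 0ℤ

-- The p-adic integers are the setoid (ℤ⟦X⟧ , _∼_), with the operations of ℤ⟦X⟧.
module p-Adic (p : ℤ) (p-prime : IsPrime p) where

  private instance
    p-nonZero : NonZero p
    p-nonZero = prime⇒nonZero p-prime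

  -- For the library's _/_ and _%_ on ℤ the remainder is nonnegative also for
  -- negative dividends, so these are the Euclidean quotient {c} and remainder [c].
  quotient : ℤ → ℤ
  quotient c = c / p

  remainder : ℤ → ℤ
  remainder c = + (c % p)

  carry : ℤ⟦X⟧ → ℤ⟦X⟧
  carry a zero    = a zero
  carry a (suc n) = a (suc n) + quotient (carry a n)

  infix 9 _♮
  _♮ : ℤ⟦X⟧ → ℤ⟦X⟧
  (a ♮) n = remainder (carry a n)

  infix 4 _∼_ _#_

  -- Equality of sequences is pointwise, as function extensionality is not available.
  _∼_ : Rel ℤ⟦X⟧ _
  a ∼ b = a ♮ ≗ b ♮

  _#_ : Rel ℤ⟦X⟧ _
  a # b = ∃[ n ] ¬ ((a ♮) n ≡ (b ♮) n)

{-# OPTIONS --safe #-}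

-- Put q n for the carry {𝐩(a) n}.  Then a - a♮ = (p - X) q, and a series determines its
-- digits modulo the multiples of p - X, so ∼ is congruence modulo the ideal (p - X) and
-- ℤ_p inherits the ring laws of ℤ⟦X⟧.  Coefficient n of a sum, of a product and of a
-- carried series only depends on the coefficients up to n of the operands; as every
-- series is equivalent to its digits, operands with the same digits up to n give results
-- with the same digit n, and contrapositively (the digits being decidable) the operations
-- reflect apartness.  Finally, if m and n are the positions of the first nonzero digits of
-- a and b, then digit m + n of a · b is the remainder of the product of these two digits,
-- which is nonzero by Euclid's lemma.
module Submission where

open import Algebra.Structures using (IsCommutativeRing)
open import Data.Integer.Base
  using (ℤ; 0ℤ; 1ℤ; +_; _+_; _*_; -_; _-_; _⊖_; _/_; _%_; ∣_∣; +<+; NonZero)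
open import Data.Integer.DivMod using (n%d<d; a≡a%n+[a/n]*n)
open import Data.Integer.Divisibility.Signed using (_∣_; divides; ∣ᵤ⇒∣; ∣⇒∣ᵤ)
open import Data.Integer.Properties
open import Data.Integer.Tactic.RingSolver using (solve-∀)
open import Data.Nat.Base as ℕ using (ℕ; zero; suc; _≤_; z≤n; s≤s; z<s; s<s)
import Data.Nat.Divisibility as ℕ
import Data.Nat.Primality as ℕ
import Data.Nat.Properties as ℕ
open import Data.Product.Base using (∃-syntax; _×_; _,_; proj₁; proj₂)
open import Data.Sum.Base using (_⊎_; inj₁; inj₂) renaming (map to map-⊎)
open import Function.Base using (_∘_)
open import Relation.Binary.PropositionalEquality
open import Relation.Nullary using (¬_; yes; no; ¬?; contradiction)
open import Relation.Nullary.Decidable using (decidable-stable)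
open import Algebra.Properties.AbelianGroup +-0-abelianGroup using (∙-cancelʳ)
open import Defs

-- Integer division with remainder, and primality

-- Two remainders below `∣ i ∣` differ by less than `∣ i ∣`, yet their difference is the multiple
-- `(q - t) * i`, so `q - t` vanishes.
%-/-unique : ∀ {d r s : ℕ} {q t i : ℤ} → ∣ i ∣ ≡ d → r ℕ.< d → s ℕ.< d →
             + r + q * i ≡ + s + t * i → r ≡ s × q ≡ t
%-/-unique {d} {r} {s} {q} {t} {i} refl r<d s<d eq = r≡s , q≡t
  where
  difference : (q - t) * i ≡ s ⊖ r
  difference = begin
    (q - t) * i                     ≡⟨ before q t i (+ r) ⟩
    + r + q * i - (+ r + t * i)     ≡⟨ cong (_- (+ r + t * i)) eq ⟩
    + s + t * i - (+ r + t * i)     ≡⟨ after t i (+ r) (+ s) ⟩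
    + s - + r                       ≡⟨ m-n≡m⊖n s r ⟩
    s ⊖ r                           ∎
    where
    open ≡-Reasoning
    before : ∀ q t i r → (q - t) * i ≡ r + q * i - (r + t * i)
    before = solve-∀
    after : ∀ t i r s → s + t * i - (r + t * i) ≡ s - r
    after = solve-∀

  small : ∣ q - t ∣ ℕ.* ∣ i ∣ ℕ.< 1 ℕ.* ∣ i ∣
  small = begin-strict
    ∣ q - t ∣ ℕ.* ∣ i ∣   ≡⟨ abs-* (q - t) i ⟨
    ∣ (q - t) * i ∣       ≡⟨ cong ∣_∣ difference ⟩
    ∣ s ⊖ r ∣             ≤⟨ ∣m⊝n∣≤m⊔n s r ⟩
    s ℕ.⊔ r               <⟨ ℕ.⊔-lub s<d r<d ⟩
    ∣ i ∣                 ≡⟨ ℕ.*-identityˡ ∣ i ∣ ⟨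
    1 ℕ.* ∣ i ∣           ∎
    where open ℕ.≤-Reasoning

  q≡t : q ≡ t
  q≡t = i-j≡0⇒i≡j q t (∣i∣≡0⇒i≡0 (ℕ.n<1⇒n≡0 (ℕ.*-cancelʳ-< ∣ i ∣ _ 1 small)))

  r≡s : r ≡ s
  r≡s = +-injective (∙-cancelʳ (t * i) (+ r) (+ s)
          (subst (λ u → + r + u * i ≡ + s + t * i) q≡t eq))

[i+j*d]%d,/d : ∀ i j d .{{_ : NonZero d}} →
               (i + j * d) % d ≡ i % d × (i + j * d) / d ≡ i / d + j
[i+j*d]%d,/d i j d = %-/-unique refl (n%d<d (i + j * d) d) (n%d<d i d) (begin
  + ((i + j * d) % d) + (i + j * d) / d * d  ≡⟨ a≡a%n+[a/n]*n (i + j * d) d ⟨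
  i + j * d                                  ≡⟨ cong (_+ j * d) (a≡a%n+[a/n]*n i d) ⟩
  + (i % d) + i / d * d + j * d              ≡⟨ regroup (+ (i % d)) (i / d) j d ⟩
  + (i % d) + (i / d + j) * d                ∎)
  where
  open ≡-Reasoning
  regroup : ∀ r q j d → r + q * d + j * d ≡ r + (q + j) * d
  regroup = solve-∀

i%d≡0⇒d∣i : ∀ i d .{{_ : NonZero d}} → i % d ≡ 0 → d ∣ i
i%d≡0⇒d∣i i d i%d≡0 = divides (i / d) (begin
  i                        ≡⟨ a≡a%n+[a/n]*n i d ⟩
  + (i % d) + i / d * d    ≡⟨ cong (λ r → + r + i / d * d) i%d≡0 ⟩
  0ℤ + i / d * d           ≡⟨ +-identityˡ _ ⟩
  i / d * d                ∎)
  where open ≡-Reasoning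

-- Gives access to Euclid's lemma, which is stated for primes in ℕ.
IsPrime⇒Prime : ∀ {p} → IsPrime p → ℕ.Prime ∣ p ∣
IsPrime⇒Prime {p} p-prime with p | IsPrime.1<p p-prime | IsPrime.divisors p-prime
... | + n | +<+ 1<n | divisors = ℕ.irreducible⇒prime irreducible
  where
  instance
    n-nonTrivial : ℕ.NonTrivial n
    n-nonTrivial = ℕ.n>1⇒nonTrivial 1<n

  irreducible : ℕ.Irreducible n
  -- `divisors` covers positive divisors only, so the divisor 0 is excluded separately: it would
  -- force `n` to be 0.
  irreducible {zero}  0∣n = contradiction (ℕ.0∣⇒≡0 0∣n) (ℕ.>⇒≢ (ℕ.<-trans z<s 1<n))
  irreducible {suc d} d∣n =
    map-⊎ +-injective +-injective (divisors (+ suc d) (+<+ z<s) (∣ᵤ⇒∣ d∣n))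

-- Ring laws for formal power series

-- By computation, `(a *ₛ b) (suc n)` is `a 0 * b (suc n) + (tail a *ₛ b) n`, and `(a *ₛ b) 0` is
-- `a 0 * b 0 + 0ℤ`. The inductions on coefficients below rest on this.
tail : ℤ⟦X⟧ → ℤ⟦X⟧
tail a = a ∘ suc

-- Multiplication by X.
shift : ℤ⟦X⟧ → ℤ⟦X⟧
shift a zero    = 0ℤ
shift a (suc n) = a n

infixl 7 _·ₛ_
_·ₛ_ : ℤ → ℤ⟦X⟧ → ℤ⟦X⟧
(k ·ₛ a) n = k * a n

+ₛ-comm : ∀ a b → a +ₛ b ≗ b +ₛ a
+ₛ-comm a b n = +-comm (a n) (b n)

infix 4 _≈[_]_
_≈[_]_ : ℤ⟦X⟧ → ℕ → ℤ⟦X⟧ → Set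
a ≈[ n ] b = ∀ k → k ≤ n → a k ≡ b k

*ₛ-local : ∀ n {a a′ b b′} → a ≈[ n ] a′ → b ≈[ n ] b′ → (a *ₛ b) n ≡ (a′ *ₛ b′) n
*ₛ-local zero    a≈a′ b≈b′ =
  cong (_+ 0ℤ) (cong₂ _*_ (a≈a′ 0 z≤n) (b≈b′ 0 z≤n))
*ₛ-local (suc n) a≈a′ b≈b′ =
  cong₂ _+_ (cong₂ _*_ (a≈a′ 0 z≤n) (b≈b′ (suc n) ℕ.≤-refl))
            (*ₛ-local n (λ k k≤n → a≈a′ (suc k) (s≤s k≤n))
                        (λ k k≤n → b≈b′ k (ℕ.m≤n⇒m≤1+n k≤n)))

*ₛ-cong-≗ : ∀ {a a′ b b′} → a ≗ a′ → b ≗ b′ → a *ₛ b ≗ a′ *ₛ b′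
*ₛ-cong-≗ a≗a′ b≗b′ n = *ₛ-local n (λ k _ → a≗a′ k) (λ k _ → b≗b′ k)

*ₛ-zeroˡ : ∀ b → 0ₛ *ₛ b ≗ 0ₛ
*ₛ-zeroˡ b zero    = refl
*ₛ-zeroˡ b (suc n) = trans (+-identityˡ _) (*ₛ-zeroˡ b n)

*ₛ-identityˡ : ∀ b → 1ₛ *ₛ b ≗ b
*ₛ-identityˡ b zero    = trans (+-identityʳ _) (*-identityˡ (b 0))
*ₛ-identityˡ b (suc n) = begin
  1ℤ * b (suc n) + (0ₛ *ₛ b) n   ≡⟨ cong₂ _+_ (*-identityˡ (b (suc n))) (*ₛ-zeroˡ b n) ⟩
  b (suc n) + 0ℤ                 ≡⟨ +-identityʳ _ ⟩
  b (suc n)                      ∎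
  where open ≡-Reasoning

*ₛ-distribʳ-+ₛ : ∀ c a b → (a +ₛ b) *ₛ c ≗ a *ₛ c +ₛ b *ₛ c
*ₛ-distribʳ-+ₛ c a b zero = expand (a 0) (b 0) (c 0)
  where
  expand : ∀ a b c → (a + b) * c + 0ℤ ≡ a * c + 0ℤ + (b * c + 0ℤ)
  expand = solve-∀
*ₛ-distribʳ-+ₛ c a b (suc n) =
  trans (cong (λ x → (a 0 + b 0) * c (suc n) + x) (*ₛ-distribʳ-+ₛ c (tail a) (tail b) n))
        (expand (a 0) (b 0) (c (suc n)) ((tail a *ₛ c) n) ((tail b *ₛ c) n))
  where
  expand : ∀ a b c x y → (a + b) * c + (x + y) ≡ a * c + x + (b * c + y)
  expand = solve-∀

·ₛ-*ₛ-assoc : ∀ k a b → (k ·ₛ a) *ₛ b ≗ k ·ₛ (a *ₛ b)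
·ₛ-*ₛ-assoc k a b zero = expand k (a 0) (b 0)
  where
  expand : ∀ k a b → k * a * b + 0ℤ ≡ k * (a * b + 0ℤ)
  expand = solve-∀
·ₛ-*ₛ-assoc k a b (suc n) =
  trans (cong (λ x → k * a 0 * b (suc n) + x) (·ₛ-*ₛ-assoc k (tail a) b n))
        (expand k (a 0) (b (suc n)) ((tail a *ₛ b) n))
  where
  expand : ∀ k a b x → k * a * b + k * x ≡ k * (a * b + x)
  expand = solve-∀

-- The tail of `a *ₛ b` is `a 0 ·ₛ tail b +ₛ tail a *ₛ b`; distributing `c` over it leaves a scalar
-- multiple and an instance of the induction hypothesis.
*ₛ-assoc : ∀ a b c → (a *ₛ b) *ₛ c ≗ a *ₛ (b *ₛ c)
*ₛ-assoc a b c zero = expand (a 0) (b 0) (c 0)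
  where
  expand : ∀ a b c → (a * b + 0ℤ) * c + 0ℤ ≡ a * (b * c + 0ℤ) + 0ℤ
  expand = solve-∀
*ₛ-assoc a b c (suc n) = begin
  (a 0 * b 0 + 0ℤ) * c₊ + ((a 0 ·ₛ tail b +ₛ tail a *ₛ b) *ₛ c) n
    ≡⟨ cong (λ x → (a 0 * b 0 + 0ℤ) * c₊ + x) (*ₛ-distribʳ-+ₛ c (a 0 ·ₛ tail b) (tail a *ₛ b) n) ⟩
  (a 0 * b 0 + 0ℤ) * c₊ + (((a 0 ·ₛ tail b) *ₛ c) n + ((tail a *ₛ b) *ₛ c) n)
    ≡⟨ cong (λ x → (a 0 * b 0 + 0ℤ) * c₊ + x)
         (cong₂ _+_ (·ₛ-*ₛ-assoc (a 0) (tail b) c n) (*ₛ-assoc (tail a) b c n)) ⟩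
  (a 0 * b 0 + 0ℤ) * c₊ + (a 0 * (tail b *ₛ c) n + (tail a *ₛ (b *ₛ c)) n)
    ≡⟨ collect (a 0) (b 0) c₊ _ _ ⟩
  a 0 * (b 0 * c₊ + (tail b *ₛ c) n) + (tail a *ₛ (b *ₛ c)) n ∎
  where
  open ≡-Reasoning
  c₊ = c (suc n)
  collect : ∀ a b c x y → (a * b + 0ℤ) * c + (a * x + y) ≡ a * (b * c + x) + y
  collect = solve-∀

-- The mirror image of the equation that defines coefficient suc n of a product.
*ₛ-suc : ∀ a b n → (a *ₛ b) (suc n) ≡ a (suc n) * b 0 + (a *ₛ tail b) n
*ₛ-suc a b zero = expand (a 0) (a 1) (b 0) (b 1)
  where
  expand : ∀ a₀ a₁ b₀ b₁ → a₀ * b₁ + (a₁ * b₀ + 0ℤ) ≡ a₁ * b₀ + (a₀ * b₁ + 0ℤ)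
  expand = solve-∀
*ₛ-suc a b (suc n) =
  trans (cong (λ x → a 0 * b (suc (suc n)) + x) (*ₛ-suc (tail a) b n))
        (exchange (a 0 * b (suc (suc n))) (a (suc (suc n)) * b 0) ((tail a *ₛ tail b) n))
  where
  exchange : ∀ x y z → x + (y + z) ≡ y + (x + z)
  exchange = solve-∀

-- Splitting off the first term of `a *ₛ b` matches splitting off the last term of `b *ₛ a`, which
-- is `*ₛ-suc`.
*ₛ-comm : ∀ a b → a *ₛ b ≗ b *ₛ a
*ₛ-comm a b zero    = cong (_+ 0ℤ) (*-comm (a 0) (b 0))
*ₛ-comm a b (suc n) = begin
  a 0 * b (suc n) + (tail a *ₛ b) n  ≡⟨ cong₂ _+_ (*-comm (a 0) (b (suc n))) (*ₛ-comm (tail a) b n) ⟩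
  b (suc n) * a 0 + (b *ₛ tail a) n  ≡⟨ *ₛ-suc b a n ⟨
  (b *ₛ a) (suc n)                   ∎
  where open ≡-Reasoning

*ₛ-distribˡ-+ₛ : ∀ c a b → c *ₛ (a +ₛ b) ≗ c *ₛ a +ₛ c *ₛ b
*ₛ-distribˡ-+ₛ c a b n = begin
  (c *ₛ (a +ₛ b)) n          ≡⟨ *ₛ-comm c (a +ₛ b) n ⟩
  ((a +ₛ b) *ₛ c) n          ≡⟨ *ₛ-distribʳ-+ₛ c a b n ⟩
  (a *ₛ c) n + (b *ₛ c) n    ≡⟨ cong₂ _+_ (*ₛ-comm a c n) (*ₛ-comm b c n) ⟩
  (c *ₛ a) n + (c *ₛ b) n    ∎
  where open ≡-Reasoning

shift-*ₛ : ∀ a b → shift a *ₛ b ≗ shift (a *ₛ b)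
shift-*ₛ a b zero    = refl
shift-*ₛ a b (suc n) = +-identityˡ _

-- Constructive because equality with `0ℤ` is decidable and the given position `n` bounds the
-- search.
leastNonzero : ∀ (a : ℤ⟦X⟧) n → a n ≢ 0ℤ →
               ∃[ m ] (∀ k → k ℕ.< m → a k ≡ 0ℤ) × a m ≢ 0ℤ
leastNonzero a zero    a₀≢0 = 0 , (λ _ ()) , a₀≢0
leastNonzero a (suc n) aₙ≢0 with a 0 ≟ 0ℤ | leastNonzero (tail a) n aₙ≢0
... | no  a₀≢0 | _                    = 0 , (λ _ ()) , a₀≢0
... | yes a₀≡0 | m , vanishes , aₘ≢0 = suc m , vanishes′ , aₘ≢0
  where
  vanishes′ : ∀ k → k ℕ.< suc m → a k ≡ 0ℤ
  vanishes′ zero    _         = a₀≡0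
  vanishes′ (suc k) (s<s k<m) = vanishes k k<m

-- Carrying and congruence modulo `p - X`

module p-AdicProperties (p : ℤ) (p-prime : IsPrime p) where

  open p-Adic p p-prime

  private instance
    p-nonZero : NonZero p
    p-nonZero = prime⇒nonZero p-prime

  -- Congruence modulo p - X, with both sides moved so that no subtraction occurs.
  infix 4 _≡ₚ_
  _≡ₚ_ : ℤ⟦X⟧ → ℤ⟦X⟧ → Set
  a ≡ₚ b = ∃[ c ] a +ₛ shift c ≗ b +ₛ p ·ₛ c

  carries : ℤ⟦X⟧ → ℤ⟦X⟧
  carries a n = quotient (carry a n)

  +-carries : ∀ a → a +ₛ shift (carries a) ≗ carry a
  +-carries a zero    = +-identityʳ (a 0)
  +-carries a (suc n) = refl

  carry-division : ∀ a n → carry a n ≡ (a ♮) n + p * carries a n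
  carry-division a n =
    trans (a≡a%n+[a/n]*n (carry a n) p) (cong (λ x → (a ♮) n + x) (*-comm (carries a n) p))

  -- Both sides equal `carry a`: once by its recursion, once by division with remainder.
  ≡ₚ-♮ : ∀ a → a ≡ₚ a ♮
  ≡ₚ-♮ a = carries a , λ n → trans (+-carries a n) (carry-division a n)

  -- Subtract the congruence of `b` with its digits from that of `a`; the digits cancel and the
  -- witnesses subtract.
  ∼⇒≡ₚ : ∀ {a b} → a ∼ b → a ≡ₚ b
  ∼⇒≡ₚ {a} {b} a∼b = carries a +ₛ -ₛ carries b , λ n → begin
    a n + shift (carries a +ₛ -ₛ carries b) n
      ≡⟨ cong (λ x → a n + x) (shift-- (carries a) (carries b) n) ⟩
    a n + (shift (carries a) n - shift (carries b) n)
      ≡⟨ +-assoc (a n) (shift (carries a) n) _ ⟨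
    a n + shift (carries a) n - shift (carries b) n
      ≡⟨ cong (_- shift (carries b) n) (trans (proj₂ (≡ₚ-♮ a) n) (cong (_+ p * carries a n) (a∼b n))) ⟩
    (b ♮) n + p * carries a n - shift (carries b) n
      ≡⟨ before ((b ♮) n) p (carries a n) (carries b n) (shift (carries b) n) ⟩
    (b ♮) n + p * carries b n + p * (carries a n - carries b n) - shift (carries b) n
      ≡⟨ cong (λ x → x + p * (carries a n - carries b n) - shift (carries b) n) (proj₂ (≡ₚ-♮ b) n) ⟨
    b n + shift (carries b) n + p * (carries a n - carries b n) - shift (carries b) n
      ≡⟨ after (b n) (shift (carries b) n) (p * (carries a n - carries b n)) ⟩
    b n + p * (carries a n - carries b n) ∎
    where
    open ≡-Reasoning
    shift-- : ∀ c d n → shift (c +ₛ -ₛ d) n ≡ shift c n - shift d n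
    shift-- c d zero    = refl
    shift-- c d (suc n) = refl
    before : ∀ x p u v s → x + p * u - s ≡ x + p * v + p * (u - v) - s
    before = solve-∀
    after : ∀ x s y → x + s + y - s ≡ x + y
    after = solve-∀

  -- The surplus `c n * p` at position `n` adds `c n` to the quotient carried onwards, which is
  -- exactly the term `shift c` contributes at `suc n`.
  ≡ₚ⇒carry : ∀ {a b} ((c , _) : a ≡ₚ b) n → carry a n ≡ carry b n + c n * p
  ≡ₚ⇒carry {a} {b} (c , eq) zero = begin
    a 0            ≡⟨ +-identityʳ (a 0) ⟨
    a 0 + 0ℤ       ≡⟨ eq 0 ⟩
    b 0 + p * c 0  ≡⟨ cong (λ x → b 0 + x) (*-comm p (c 0)) ⟩
    b 0 + c 0 * p  ∎
    where open ≡-Reasoning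
  ≡ₚ⇒carry {a} {b} a≡b@(c , eq) (suc n) = begin
    a (suc n) + carry a n / p                    ≡⟨ cong (λ x → a (suc n) + x / p) (≡ₚ⇒carry {a} {b} a≡b n) ⟩
    a (suc n) + (carry b n + c n * p) / p        ≡⟨ cong (λ x → a (suc n) + x) (proj₂ ([i+j*d]%d,/d (carry b n) (c n) p)) ⟩
    a (suc n) + (carries b n + c n)              ≡⟨ before (a (suc n)) (carries b n) (c n) ⟩
    a (suc n) + c n + carries b n                ≡⟨ cong (_+ carries b n) (eq (suc n)) ⟩
    b (suc n) + p * c (suc n) + carries b n      ≡⟨ after (b (suc n)) p (c (suc n)) (carries b n) ⟩
    b (suc n) + carries b n + c (suc n) * p      ∎
    where
    open ≡-Reasoning
    before : ∀ a q c → a + (q + c) ≡ a + c + q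
    before = solve-∀
    after : ∀ b p c q → b + p * c + q ≡ b + q + c * p
    after = solve-∀

  ≡ₚ⇒∼ : ∀ {a b} → a ≡ₚ b → a ∼ b
  ≡ₚ⇒∼ {a} {b} a≡b@(c , _) n = cong +_
    (trans (cong (_% p) (≡ₚ⇒carry {a} {b} a≡b n)) (proj₁ ([i+j*d]%d,/d (carry b n) (c n) p)))

  carry-local : ∀ n {a b} → a ≈[ n ] b → carry a n ≡ carry b n
  carry-local zero    a≈b = a≈b 0 z≤n
  carry-local (suc n) a≈b =
    cong₂ _+_ (a≈b (suc n) ℕ.≤-refl)
              (cong quotient (carry-local n (λ k k≤n → a≈b k (ℕ.m≤n⇒m≤1+n k≤n))))

  ♮-local : ∀ n {a b} → a ≈[ n ] b → (a ♮) n ≡ (b ♮) n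
  ♮-local n a≈b = cong remainder (carry-local n a≈b)

  ≗⇒∼ : ∀ {a b} → a ≗ b → a ∼ b
  ≗⇒∼ a≗b n = ♮-local n (λ k _ → a≗b k)

  ∼-sym : ∀ {a b} → a ∼ b → b ∼ a
  ∼-sym a∼b n = sym (a∼b n)

  ∼-trans : ∀ {a b c} → a ∼ b → b ∼ c → a ∼ c
  ∼-trans a∼b b∼c n = trans (a∼b n) (b∼c n)

  ∼-♮ : ∀ a → a ∼ a ♮
  ∼-♮ a = ≡ₚ⇒∼ {a} {a ♮} (≡ₚ-♮ a)

  -- The ring operations on the quotient

  +ₛ-congʳ : ∀ c {a b} → a ∼ b → a +ₛ c ∼ b +ₛ c
  +ₛ-congʳ c {a} {b} a∼b with ∼⇒≡ₚ {a} {b} a∼b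
  ... | d , eq = ≡ₚ⇒∼ {a +ₛ c} {b +ₛ c} (d , λ n → begin
    a n + c n + shift d n    ≡⟨ exchange (a n) (c n) (shift d n) ⟩
    a n + shift d n + c n    ≡⟨ cong (_+ c n) (eq n) ⟩
    b n + p * d n + c n      ≡⟨ exchange (b n) (p * d n) (c n) ⟩
    b n + c n + p * d n      ∎)
    where
    open ≡-Reasoning
    exchange : ∀ x y z → x + y + z ≡ x + z + y
    exchange = solve-∀

  +ₛ-congˡ : ∀ c {a b} → a ∼ b → c +ₛ a ∼ c +ₛ b
  +ₛ-congˡ c {a} {b} a∼b =
    ∼-trans (≗⇒∼ (+ₛ-comm c a)) (∼-trans (+ₛ-congʳ c {a} {b} a∼b) (≗⇒∼ (+ₛ-comm b c)))

  -ₛ-cong : ∀ {a b} → a ∼ b → -ₛ a ∼ -ₛ b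
  -ₛ-cong {a} {b} a∼b with ∼⇒≡ₚ {a} {b} a∼b
  ... | d , eq = ≡ₚ⇒∼ { -ₛ a} { -ₛ b} (-ₛ d , λ n → begin
    - a n + shift (-ₛ d) n    ≡⟨ cong (λ x → - a n + x) (shift-neg n) ⟩
    - a n + - shift d n       ≡⟨ neg-distrib-+ (a n) (shift d n) ⟨
    - (a n + shift d n)       ≡⟨ cong -_ (eq n) ⟩
    - (b n + p * d n)         ≡⟨ expand (b n) p (d n) ⟩
    - b n + p * - d n         ∎)
    where
    open ≡-Reasoning
    shift-neg : ∀ n → shift (-ₛ d) n ≡ - shift d n
    shift-neg zero    = refl
    shift-neg (suc n) = refl
    expand : ∀ b p d → - (b + p * d) ≡ - b + p * - d
    expand = solve-∀

  *ₛ-congʳ : ∀ c {a b} → a ∼ b → a *ₛ c ∼ b *ₛ c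
  *ₛ-congʳ c {a} {b} a∼b with ∼⇒≡ₚ {a} {b} a∼b
  -- Multiples of `p - X` form an ideal: multiplying by `c` turns the witness `d` into `d *ₛ c`.
  ... | d , eq = ≡ₚ⇒∼ {a *ₛ c} {b *ₛ c} (d *ₛ c , λ n → begin
    (a *ₛ c) n + shift (d *ₛ c) n        ≡⟨ cong (λ x → (a *ₛ c) n + x) (shift-*ₛ d c n) ⟨
    (a *ₛ c) n + (shift d *ₛ c) n        ≡⟨ *ₛ-distribʳ-+ₛ c a (shift d) n ⟨
    ((a +ₛ shift d) *ₛ c) n              ≡⟨ *ₛ-cong-≗ {b = c} eq (λ _ → refl) n ⟩
    ((b +ₛ p ·ₛ d) *ₛ c) n               ≡⟨ *ₛ-distribʳ-+ₛ c b (p ·ₛ d) n ⟩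
    (b *ₛ c) n + ((p ·ₛ d) *ₛ c) n       ≡⟨ cong (λ x → (b *ₛ c) n + x) (·ₛ-*ₛ-assoc p d c n) ⟩
    (b *ₛ c) n + p * (d *ₛ c) n          ∎)
    where open ≡-Reasoning

  *ₛ-congˡ : ∀ c {a b} → a ∼ b → c *ₛ a ∼ c *ₛ b
  *ₛ-congˡ c {a} {b} a∼b =
    ∼-trans (≗⇒∼ (*ₛ-comm c a)) (∼-trans (*ₛ-congʳ c {a} {b} a∼b) (≗⇒∼ (*ₛ-comm b c)))

  *ₛ-cong : ∀ {a b c d} → a ∼ b → c ∼ d → a *ₛ c ∼ b *ₛ d
  *ₛ-cong {a} {b} {c} {d} a∼b c∼d =
    ∼-trans (*ₛ-congʳ c {a} {b} a∼b) (*ₛ-congˡ b {c} {d} c∼d)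

  isCommutativeRing : IsCommutativeRing _∼_ _+ₛ_ _*ₛ_ -ₛ_ 0ₛ 1ₛ
  isCommutativeRing = record
    { isRing = record
      { +-isAbelianGroup = record
        { isGroup = record
          { isMonoid = record
            { isSemigroup = record
              { isMagma = record
                { isEquivalence = record
                  { refl  = λ _ → refl
                  ; sym   = ∼-sym
                  ; trans = ∼-trans
                  }
                ; ∙-cong = λ {a} {b} {c} {d} a∼b c∼d →
                    ∼-trans (+ₛ-congʳ c {a} {b} a∼b) (+ₛ-congˡ b {c} {d} c∼d)
                }
              ; assoc = λ a b c → ≗⇒∼ λ n → +-assoc (a n) (b n) (c n)
              }
            ; identity = (λ a → ≗⇒∼ λ n → +-identityˡ (a n))
                       , (λ a → ≗⇒∼ λ n → +-identityʳ (a n))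
            }
          ; inverse = (λ a → ≗⇒∼ λ n → +-inverseˡ (a n))
                    , (λ a → ≗⇒∼ λ n → +-inverseʳ (a n))
          ; ⁻¹-cong = λ {a} {b} → -ₛ-cong {a} {b}
          }
        ; comm = λ a b → ≗⇒∼ (+ₛ-comm a b)
        }
      ; *-cong = λ {a} {b} {c} {d} → *ₛ-cong {a} {b} {c} {d}
      ; *-assoc = λ a b c → ≗⇒∼ (*ₛ-assoc a b c)
      ; *-identity = (λ a → ≗⇒∼ (*ₛ-identityˡ a))
                   , (λ a → ≗⇒∼ λ n → trans (*ₛ-comm a 1ₛ n) (*ₛ-identityˡ a n))
      ; distrib = (λ c a b → ≗⇒∼ (*ₛ-distribˡ-+ₛ c a b))
                , (λ c a b → ≗⇒∼ (*ₛ-distribʳ-+ₛ c a b))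
      }
    ; *-comm = λ a b → ≗⇒∼ (*ₛ-comm a b)
    }

  -- Apartness and its compatibility with the operations

  #-cotrans : ∀ {a b} → a # b → ∀ c → (a # c) ⊎ (c # b)
  #-cotrans {a} {b} (n , aₙ≢bₙ) c with (a ♮) n ≟ (c ♮) n
  ... | yes aₙ≡cₙ = inj₂ (n , λ cₙ≡bₙ → aₙ≢bₙ (trans aₙ≡cₙ cₙ≡bₙ))
  ... | no  aₙ≢cₙ = inj₁ (n , aₙ≢cₙ)

  -- A decidable search among the digits up to `n` either finds a difference or shows that all
  -- agree. Locality concerns coefficients rather than digits, so in the second case `f-cong` first
  -- replaces `a` and `b` by their digit series.
  local⇒reflects-# : (f : ℤ⟦X⟧ → ℤ⟦X⟧) →
                     (∀ {a b} → a ∼ b → f a ∼ f b) →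
                     (∀ n {a b} → a ≈[ n ] b → f a n ≡ f b n) →
                     ∀ a b → f a # f b → a # b
  local⇒reflects-# f f-cong f-local a b (n , fa≢fb)
    -- The search bound is strict, hence `suc n` to include position `n`.
    with ℕ.anyUpTo? (λ k → ¬? ((a ♮) k ≟ (b ♮) k)) (suc n)
  ... | yes (k , _ , aₖ≢bₖ) = k , aₖ≢bₖ
  ... | no  none            = contradiction fa≡fb fa≢fb
    where
    a♮≈b♮ : a ♮ ≈[ n ] b ♮
    a♮≈b♮ k k≤n = decidable-stable ((a ♮) k ≟ (b ♮) k) (λ aₖ≢bₖ → none (k , s≤s k≤n , aₖ≢bₖ))

    fa≡fb : (f a ♮) n ≡ (f b ♮) n
    fa≡fb = begin
      (f a ♮) n        ≡⟨ f-cong (∼-♮ a) n ⟩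
      (f (a ♮) ♮) n    ≡⟨ ♮-local n (λ k k≤n → f-local k (λ j j≤k → a♮≈b♮ j (ℕ.≤-trans j≤k k≤n))) ⟩
      (f (b ♮) ♮) n    ≡⟨ f-cong (∼-♮ b) n ⟨
      (f b ♮) n        ∎
      where open ≡-Reasoning

  isCommutativeRingWithCompatibleApartness :
    IsCommutativeRingWithCompatibleApartness _∼_ _#_ _+ₛ_ _*ₛ_ -ₛ_ 0ₛ 1ₛ
  isCommutativeRingWithCompatibleApartness = record
    { isCommutativeRing = isCommutativeRing
    ; #-resp-≈ = (λ b∼c (n , a≢b) → n , λ a≡c → a≢b (trans a≡c (sym (b∼c n))))
               , (λ a∼c (n , a≢b) → n , λ c≡b → a≢b (trans (a∼c n) c≡b))
    ; isApartnessRelation = record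
      { irrefl  = λ a∼b (n , a≢b) → a≢b (a∼b n)
      ; sym     = λ (n , a≢b) → n , λ b≡a → a≢b (sym b≡a)
      ; cotrans = λ {a} {b} → #-cotrans {a} {b}
      }
    ; +-reflects-# = λ a b c → local⇒reflects-# (c +ₛ_) (λ {a} {b} → +ₛ-congˡ c {a} {b})
        (λ n a≈b → cong (λ x → c n + x) (a≈b n ℕ.≤-refl)) a b
    ; *-reflects-# = λ a b c → local⇒reflects-# (c *ₛ_) (λ {a} {b} → *ₛ-congˡ c {a} {b})
        (λ n → *ₛ-local n {c} (λ _ _ → refl)) a b
    }

  -- Leading digits and the domain property

  p∤nonzeroDigit : ∀ {d} → d ℕ.< ∣ p ∣ → + d ≢ 0ℤ → ¬ ∣ p ∣ ℕ.∣ d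
  p∤nonzeroDigit {zero}  _   d≢0 _   = d≢0 refl
  p∤nonzeroDigit {suc d} d<p _   p∣d = ℕ.>⇒∤ d<p p∣d

  0%p≡0,0/p≡0 : 0ℤ % p ≡ 0 × 0ℤ / p ≡ 0ℤ
  0%p≡0,0/p≡0 = %-/-unique {s = 0} {t = 0ℤ} refl
    (n%d<d 0ℤ p) (ℕ.≤-<-trans z≤n (n%d<d 0ℤ p)) (sym (a≡a%n+[a/n]*n 0ℤ p))

  -- A zero head carries nothing, so carrying commutes with division by X.
  carry-suc : ∀ {a b} → a 0 ≡ 0ℤ → tail a ≗ b → ∀ n → carry a (suc n) ≡ carry b n
  carry-suc {a} {b} a₀≡0 a₊≗b zero = begin
    a 1 + quotient (a 0)  ≡⟨ cong₂ _+_ (a₊≗b 0) (cong quotient a₀≡0) ⟩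
    b 0 + quotient 0ℤ     ≡⟨ cong (λ x → b 0 + x) (proj₂ 0%p≡0,0/p≡0) ⟩
    b 0 + 0ℤ              ≡⟨ +-identityʳ (b 0) ⟩
    b 0                   ∎
    where open ≡-Reasoning
  carry-suc {a} {b} a₀≡0 a₊≗b (suc n) =
    cong₂ _+_ (a₊≗b (suc n)) (cong quotient (carry-suc {a} {b} a₀≡0 a₊≗b n))

  0ₛ♮ : ∀ n → (0ₛ ♮) n ≡ 0ℤ
  0ₛ♮ n = cong +_ (trans (cong (_% p) (carry-0ₛ n)) (proj₁ 0%p≡0,0/p≡0))
    where
    carry-0ₛ : ∀ n → carry 0ₛ n ≡ 0ℤ
    carry-0ₛ zero    = refl
    carry-0ₛ (suc n) = trans (carry-suc {0ₛ} {0ₛ} refl (λ _ → refl) n) (carry-0ₛ n)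

  -- Each leading zero of `a` or `b` makes the head of the product zero, and `carry-suc` strips it.
  -- When none remain, the coefficient is the product of the two heads, with nothing carried in.
  carry-*ₛ-leading : ∀ m n {a b} → (∀ k → k ℕ.< m → a k ≡ 0ℤ) → (∀ k → k ℕ.< n → b k ≡ 0ℤ) →
                     carry (a *ₛ b) (m ℕ.+ n) ≡ a m * b n
  carry-*ₛ-leading zero zero {a} {b} _ _ = +-identityʳ (a 0 * b 0)
  carry-*ₛ-leading zero (suc n) {a} {b} a<m b<n =
    trans (carry-suc {a *ₛ b} {a *ₛ tail b} head-zero tail-* n)
          (carry-*ₛ-leading zero n a<m (λ k k<n → b<n (suc k) (s<s k<n)))
    where
    open ≡-Reasoning
    head-zero : a 0 * b 0 + 0ℤ ≡ 0ℤ
    head-zero = trans (+-identityʳ _) (trans (cong (a 0 *_) (b<n 0 z<s)) (*-zeroʳ (a 0)))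
    tail-* : tail (a *ₛ b) ≗ a *ₛ tail b
    tail-* k = begin
      (a *ₛ b) (suc k)                      ≡⟨ *ₛ-suc a b k ⟩
      a (suc k) * b 0 + (a *ₛ tail b) k     ≡⟨ cong (λ x → a (suc k) * x + (a *ₛ tail b) k) (b<n 0 z<s) ⟩
      a (suc k) * 0ℤ + (a *ₛ tail b) k      ≡⟨ cong (_+ (a *ₛ tail b) k) (*-zeroʳ (a (suc k))) ⟩
      0ℤ + (a *ₛ tail b) k                  ≡⟨ +-identityˡ _ ⟩
      (a *ₛ tail b) k                       ∎
  carry-*ₛ-leading (suc m) n {a} {b} a<m b<n =
    trans (carry-suc {a *ₛ b} {tail a *ₛ b} head-zero tail-* (m ℕ.+ n))
          (carry-*ₛ-leading m n (λ k k<m → a<m (suc k) (s<s k<m)) b<n)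
    where
    open ≡-Reasoning
    head-zero : a 0 * b 0 + 0ℤ ≡ 0ℤ
    head-zero = trans (+-identityʳ _) (cong (_* b 0) (a<m 0 z<s))
    tail-* : tail (a *ₛ b) ≗ tail a *ₛ b
    tail-* k = trans (cong (λ x → x * b (suc k) + (tail a *ₛ b) k) (a<m 0 z<s)) (+-identityˡ _)

  %p≡0⇒p∣ : ∀ i → i % p ≡ 0 → ∣ p ∣ ℕ.∣ ∣ i ∣
  %p≡0⇒p∣ i i%p≡0 = ∣⇒∣ᵤ (i%d≡0⇒d∣i i p i%p≡0)

  -- By Euclid's lemma `p` would divide one of the digits, but a nonzero digit is smaller than `p`.
  nonzeroDigits⇒*-%p≢0 : ∀ {c d} → c ℕ.< ∣ p ∣ → d ℕ.< ∣ p ∣ → + c ≢ 0ℤ → + d ≢ 0ℤ →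
                         remainder (+ c * + d) ≢ 0ℤ
  nonzeroDigits⇒*-%p≢0 {c} {d} c<p d<p c≢0 d≢0 cd%p≡0
    with ℕ.euclidsLemma c d (IsPrime⇒Prime p-prime)
           (subst (∣ p ∣ ℕ.∣_) (abs-* (+ c) (+ d)) (%p≡0⇒p∣ (+ c * + d) (+-injective cd%p≡0)))
  ... | inj₁ p∣c = p∤nonzeroDigit c<p c≢0 p∣c
  ... | inj₂ p∣d = p∤nonzeroDigit d<p d≢0 p∣d

  1#0 : 1ₛ # 0ₛ
  -- Position 0 receives no carry: equal digits there would make `p` divide 1.
  1#0 = 0 , λ 1%p≡0%p →
    ℕ.nonTrivial⇒≢1 {{ℕ.prime⇒nonTrivial (IsPrime⇒Prime p-prime)}}
      (ℕ.∣1⇒≡1 (%p≡0⇒p∣ 1ℤ (+-injective (trans 1%p≡0%p (0ₛ♮ 0)))))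

  leadingDigit : ∀ a → a # 0ₛ → ∃[ m ] (∀ k → k ℕ.< m → (a ♮) k ≡ 0ℤ) × (a ♮) m ≢ 0ℤ
  leadingDigit a (n , aₙ≢0ₙ) = leastNonzero (a ♮) n (λ aₙ≡0 → aₙ≢0ₙ (trans aₙ≡0 (sym (0ₛ♮ n))))

  *-#0 : ∀ a b → a # 0ₛ → b # 0ₛ → a *ₛ b # 0ₛ
  *-#0 a b a#0 b#0 with leadingDigit a a#0 | leadingDigit b b#0
  ... | m , a<m , aₘ≢0 | n , b<n , bₙ≢0 = m ℕ.+ n , λ ab≡0 →
    nonzeroDigits⇒*-%p≢0 (n%d<d (carry a m) p) (n%d<d (carry b n) p) aₘ≢0 bₙ≢0 (begin
      -- The vanishing below `m` and `n` holds for digits, not for the coefficients of `a` and `b`,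
      -- so the product is computed on the digit series and transported by `*ₛ-cong`.
      remainder ((a ♮) m * (b ♮) n)         ≡⟨ cong remainder (carry-*ₛ-leading m n a<m b<n) ⟨
      ((a ♮ *ₛ b ♮) ♮) (m ℕ.+ n)            ≡⟨ *ₛ-cong {a} {a ♮} {b} {b ♮} (∼-♮ a) (∼-♮ b) (m ℕ.+ n) ⟨
      ((a *ₛ b) ♮) (m ℕ.+ n)                ≡⟨ ab≡0 ⟩
      (0ₛ ♮) (m ℕ.+ n)                      ≡⟨ 0ₛ♮ (m ℕ.+ n) ⟩
      0ℤ                                    ∎)
    where open ≡-Reasoning

theorem6p14 : (p : ℤ) (p-prime : IsPrime p) →
    let open p-Adic p p-prime in
    IsApartnessDomain _∼_ _#_ _+ₛ_ _*ₛ_ -ₛ_ 0ₛ 1ₛ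
theorem6p14 p p-prime = record
  { isCommutativeRingWithCompatibleApartness = isCommutativeRingWithCompatibleApartness
  ; 1#0  = 1#0
  ; *-#0 = *-#0
  }
  where open p-AdicProperties p p-prime
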